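{- Given a time-inconsistent planning model $M=(G,w,s,t,p,\beta)$, the expectation $\mathbf{E}(X_\beta)$ and the variance $\mathbf{Var}(X_\beta)$ can be computed in time $\mathcal{O}(n^3)$, where $n$ is the number of vertices of $G$.
   Context: A time-inconsistent planning model is a tuple $M=(G,w,s,t,p,\beta)$ where $G$ is a finite directed acyclic graph with $n$ vertices, $w:E(G)\to\mathbb{N}$ are arc costs, $s,t\in V(G)$ with $t$ reachable from $s$, and $\beta\le 1$ is the present-bias parameter. For a $v$-$t$ path $P$ with arcs $e_1,\dots,e_m$, its perceived cost is $\zeta(P)=w(e_1)+\beta\sum_{i=2}^m w(e_i)$; $\zeta(v)$ is the minimum perceived cost over all $v$-$t$ paths, and a $v$-$t$ path attaining it is a perceived path. The function $p$ assigns to each arc $uv$ a probability $p(u,v)\ge 0$ such that $\sum_{uv\in E(G)}p(u,v)=1$ for every vertex $u\ne t$ from which $t$ is reachable, and $p(u,v)>0$ only if $uv$ is the first arc of some perceived $u$-$t$ path. The agent starts at $s$ and at each vertex $u\neq t$ moves along arc $uv$ with probability $p(u,v)$, until it reaches $t$. $C_\beta$ is the random variable equal to the actual cost (sum of $w$) of the $s$-$t$ path traversed, $d(s,t)$ is the minimum cost of an $s$-$t$ path, and $X_\beta=C_\beta/d(s,t)$. -}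

module Defs where

open import Algebra.Bundles using (CommutativeRing)
import Algebra.Definitions.RawMonoid as RawMonoidDefinitions
open import Algebra.Structures using (IsCommutativeRing)
open import Data.Bool.Base using (Bool; true; false; T; not; _∧_; if_then_else_)
open import Data.Bool.Properties using (T?; T-irrelevant)
open import Data.Empty using (⊥-elim)
open import Data.Fin.Base as Fin using (Fin; toℕ; fromℕ<)
import Data.Fin.Properties as Fin
open import Data.List.Base using (List; []; _∷_; map; foldr; concatMap; allFin)
open import Data.List.Extrema.Nat using (min; min≤v⁺; argmin-sel)
open import Data.List.Membership.Propositional using (_∈_)
open import Data.List.Membership.Propositional.Properties using (∈-map⁺; ∈-map⁻; ∈-concatMap⁺; ∈-allFin)
open import Data.List.Relation.Binary.Disjoint.Propositional using (Disjoint)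
open import Data.List.Relation.Unary.All as All using ([]; _∷_)
open import Data.List.Relation.Unary.AllPairs as AllPairs using ([]; _∷_)
import Data.List.Relation.Unary.AllPairs.Properties as AllPairs
import Data.List.Relation.Unary.All.Properties as All
open import Data.List.Relation.Unary.Any as Any using (here)
open import Data.List.Relation.Unary.Unique.Propositional using (Unique)
import Data.List.Relation.Unary.Unique.Propositional.Properties as Unique
open import Data.Nat.Base as ℕ using (ℕ; zero; suc; _≡ᵇ_; _≤ᵇ_)
import Data.Nat.Properties as ℕ
open import Data.Product.Base using (∃; _×_; _,_)
open import Data.Sum.Base using (inj₁; inj₂)
import Data.Rational.Base as ℚ
import Data.Rational.Properties as ℚ
open import Function.Base using (id)
open import Level using (_⊔_; 0ℓ) renaming (suc to lsuc)
open import Relation.Binary.Construct.Closure.ReflexiveTransitive using (Star; ε; _◅_)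
open import Relation.Binary.Construct.Closure.Transitive using (TransClosure; [_]; _∷_)
import Relation.Binary.Construct.NonStrictToStrict as NonStrictToStrict
open import Relation.Binary.Core using (Rel)
open import Relation.Binary.PropositionalEquality using (_≡_; _≢_; refl; sym; cong; subst)
open import Relation.Binary.Structures using (IsDecTotalOrder)
open import Relation.Nullary using (¬_; does; yes; no; contradiction)

-- The number domain for β and for the probabilities: any field with a
-- decidable compatible total order.  The inverse is total, but its value
-- at 0# is unconstrained.

record OrderedField c ℓ₁ ℓ₂ : Set (lsuc (c ⊔ ℓ₁ ⊔ ℓ₂)) where
  infix  8 -_ _⁻¹
  infixl 7 _*_ _/_
  infixl 6 _+_ _-_
  infix  4 _≈_ _≉_ _≤_
  field
    Carrier           : Set c
    _≈_               : Rel Carrier ℓ₁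
    _≤_               : Rel Carrier ℓ₂
    _+_ _*_           : Carrier → Carrier → Carrier
    -_ _⁻¹            : Carrier → Carrier
    0# 1#             : Carrier
    isCommutativeRing : IsCommutativeRing _≈_ _+_ _*_ -_ 0# 1#
    isDecTotalOrder   : IsDecTotalOrder _≈_ _≤_

  _≉_ : Rel Carrier ℓ₁
  x ≉ y = ¬ (x ≈ y)

  field
    0≉1        : 0# ≉ 1#
    ⁻¹-cong    : ∀ {x y} → x ≈ y → x ⁻¹ ≈ y ⁻¹
    ⁻¹-inverse : ∀ {x} → x ≉ 0# → x * x ⁻¹ ≈ 1#
    +-mono-≤   : ∀ {x y u v} → x ≤ y → u ≤ v → x + u ≤ y + v
    *-nonneg   : ∀ {x y} → 0# ≤ x → 0# ≤ y → 0# ≤ x * y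

  commutativeRing : CommutativeRing c ℓ₁
  commutativeRing = record { isCommutativeRing = isCommutativeRing }

  open IsDecTotalOrder isDecTotalOrder public using (_≟_; _≤?_)
  open NonStrictToStrict _≈_ _≤_ public using (_<_)
  open RawMonoidDefinitions (CommutativeRing.+-rawMonoid commutativeRing) public
    using (sum) renaming (_×_ to _×#_)

  _-_ _/_ : Carrier → Carrier → Carrier
  x - y = x + - y
  x / y = x * y ⁻¹

  fromℕ : ℕ → Carrier
  fromℕ k = k ×# 1#

  sumOver : ∀ {a} {A : Set a} → List A → (A → Carrier) → Carrier
  sumOver xs f = foldr (λ x acc → f x + acc) 0# xs

ℚ-orderedField : OrderedField 0ℓ 0ℓ 0ℓ
ℚ-orderedField = record
  { Carrier           = ℚ.ℚ
  ; _≈_               = _≡_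
  ; _≤_               = ℚ._≤_
  ; _+_               = ℚ._+_
  ; _*_               = ℚ._*_
  ; -_                = ℚ.-_
  ; _⁻¹               = inv
  ; 0#                = ℚ.0ℚ
  ; 1#                = ℚ.1ℚ
  ; isCommutativeRing = ℚ.+-*-isCommutativeRing
  ; isDecTotalOrder   = ℚ.≤-isDecTotalOrder
  ; 0≉1               = λ ()
  ; ⁻¹-cong           = cong inv
  ; ⁻¹-inverse        = λ {x} → inverse x
  ; +-mono-≤          = ℚ.+-mono-≤
  ; *-nonneg          = λ {x} {y} 0≤x 0≤y →
      ℚ.nonNegative⁻¹ (x ℚ.* y)
        {{ℚ.nonNeg*nonNeg⇒nonNeg x {{ℚ.nonNegative 0≤x}} y {{ℚ.nonNegative 0≤y}}}}
  }
  where
  inv : ℚ.ℚ → ℚ.ℚ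
  inv x with x ℚ.≟ ℚ.0ℚ
  ... | yes _  = ℚ.0ℚ
  ... | no x≢0 = ℚ.1/_ x {{ℚ.≢-nonZero x≢0}}

  inverse : ∀ x → x ≢ ℚ.0ℚ → x ℚ.* inv x ≡ ℚ.1ℚ
  inverse x x≢0 with x ℚ.≟ ℚ.0ℚ
  ... | yes x≡0 = contradiction x≡0 x≢0
  ... | no  x≢0 = ℚ.*-inverseʳ x {{ℚ.≢-nonZero x≢0}}

module _ {c ℓ₁ ℓ₂} (K : OrderedField c ℓ₁ ℓ₂) where
  private
    module K = OrderedField K
  open K using (Carrier; 0#; 1#)

  -- The tuple (G,w,s,t,p,β), before the conditions on p and β.
  record PlanningTuple : Set c where
    field
      n   : ℕ
      adj : Fin n → Fin n → Bool

    V : Set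
    V = Fin n

    Arc : V → V → Set
    Arc u v = T (adj u v)

    -- In an acyclic graph no walk repeats a vertex, so paths are walks.
    Path : V → V → Set
    Path = Star Arc

    field
      acyclic   : ∀ {v} → ¬ TransClosure Arc v v
      w         : ∀ {u v} → Arc u v → ℕ
      s t       : V
      reachable : Path s t
      β         : Carrier
      p         : ∀ {u v} → Arc u v → Carrier

    arcMatrix : ∀ {a} {A : Set a} → A → (∀ {u v} → Arc u v → A) → V → V → A
    arcMatrix default f u v with T? (adj u v)
    ... | yes e = f e
    ... | no  _ = default

    cost : ∀ {u v} → Path u v → ℕ
    cost ε       = 0
    cost (e ◅ P) = w e ℕ.+ cost P

    ζ : ∀ {v} → Path v t → Carrier
    ζ ε       = 0#
    ζ (e ◅ P) = K.fromℕ (w e) K.+ β K.* K.fromℕ (cost P)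

    IsPerceived : ∀ {v} → Path v t → Set ℓ₂
    IsPerceived {v} P = (Q : Path v t) → ζ P K.≤ ζ Q

  record Model : Set (c ⊔ ℓ₁ ⊔ ℓ₂) where
    field
      tuple : PlanningTuple

    open PlanningTuple tuple public

    field
      β≤1         : β K.≤ 1#
      p-nonneg    : ∀ {u v} (e : Arc u v) → 0# K.≤ p e
      p-sum       : ∀ u → u ≢ t → Path u t → K.sum (arcMatrix 0# p u) K.≈ 1#
      p-perceived : ∀ {u v} (e : Arc u v) → 0# K.< p e → ∃ λ (P : Path v t) → IsPerceived (e ◅ P)

module _ {c ℓ₁ ℓ₂} {K : OrderedField c ℓ₁ ℓ₂} (M : Model K) where
  open OrderedField K using (Carrier; 0#; 1#; fromℕ; sumOver)
  private
    module K = OrderedField K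
  open Model M

  -- All trajectories of at most k arcs of an agent that starts at u and
  -- stops at t.
  mutual
    trajectories : ℕ → (u : V) → List (Path u t)
    trajectories k u with u Fin.≟ t
    ... | yes refl = ε ∷ []
    ... | no  _    = moves k u

    moves : ℕ → (u : V) → List (Path u t)
    moves zero    u = []
    moves (suc k) u = concatMap (moveTo k u) (allFin n)

    moveTo : ℕ → (u v : V) → List (Path u t)
    moveTo k u v with T? (adj u v)
    ... | yes e = map (e ◅_) (trajectories k v)
    ... | no  _ = []

  -- The sample space: every s-t path, exactly once (outcomes-complete and
  -- outcomes-unique below).  By acyclicity n is enough fuel.
  outcomes : List (Path s t)
  outcomes = trajectories n s

  probability : ∀ {u v} → Path u v → Carrier
  probability ε       = 1#
  probability (e ◅ P) = p e K.* probability P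

  𝔼 : (Path s t → Carrier) → Carrier
  𝔼 Y = sumOver outcomes (λ P → probability P K.* Y P)

  Var : (Path s t → Carrier) → Carrier
  Var Y = 𝔼 (λ P → (Y P K.- 𝔼 Y) K.* (Y P K.- 𝔼 Y))

  -- d(s,t); that it is attained and a lower bound is proved below.
  distance : ℕ
  distance = min (cost reachable) (map cost outcomes)

  -- The ratio C_β / d(s,t), meaningful only when distance is non-zero.
  X : Path s t → Carrier
  X P = fromℕ (cost P) K./ fromℕ distance

  arcs : ∀ {u v} → Path u v → ℕ
  arcs ε       = 0
  arcs (_ ◅ P) = suc (arcs P)

  vertex : ∀ {u v} (P : Path u v) → Fin (suc (arcs P)) → V
  vertex {u} P       Fin.zero    = u
  vertex     (_ ◅ P) (Fin.suc i) = vertex P i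

  prefix : ∀ {x u v} → Arc x u → (P : Path u v) (i : Fin (suc (arcs P))) →
           TransClosure Arc x (vertex P i)
  prefix e P       Fin.zero    = [ e ]
  prefix e (f ◅ P) (Fin.suc i) = e ∷ prefix f P i

  segment : ∀ {u v} (P : Path u v) {i j} → i Fin.< j →
            TransClosure Arc (vertex P i) (vertex P j)
  segment (e ◅ P) {Fin.zero}  {Fin.suc j} _           = prefix e P j
  segment (e ◅ P) {Fin.suc i} {Fin.suc j} (ℕ.s≤s i<j) = segment P i<j

  arcs<n : ∀ {u v} (P : Path u v) → arcs P ℕ.< n
  arcs<n P with n ℕ.≤? arcs P
  ... | no  n≰ = ℕ.≰⇒> n≰
  ... | yes n≤ with i , j , i<j , eq ← Fin.pigeonhole (ℕ.s≤s n≤) (vertex P) =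
    ⊥-elim (acyclic (subst (TransClosure Arc (vertex P i)) (sym eq) (segment P i<j)))

  path⁺ : ∀ {u v x} → Arc u v → Path v x → TransClosure Arc u x
  path⁺ e ε       = [ e ]
  path⁺ e (f ◅ P) = e ∷ path⁺ f P

  ∈-trajectories : ∀ {k u} (P : Path u t) → arcs P ℕ.≤ k → P ∈ trajectories k u
  ∈-trajectories {u = u} P le with u Fin.≟ t
  ∈-trajectories ε       le | yes refl = here refl
  ∈-trajectories (e ◅ P) le | yes refl = ⊥-elim (acyclic (path⁺ e P))
  ∈-trajectories ε       le | no  t≢t  = contradiction refl t≢t
  ∈-trajectories {suc k} {u} (_◅_ {j = v} e P) (ℕ.s≤s le) | no _ =
    ∈-concatMap⁺ (moveTo k u) (Any.map at (∈-allFin v))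
    where
    at : ∀ {v′} → v ≡ v′ → (e ◅ P) ∈ moveTo k u v′
    at refl with T? (adj u v)
    ... | yes e′ rewrite T-irrelevant e e′ = ∈-map⁺ (e′ ◅_) (∈-trajectories P le)
    ... | no ¬e  = contradiction e ¬e

  ◅-injective : ∀ {u v x} {e : Arc u v} {P Q : Path v x} →
                _≡_ {A = Path u x} (e ◅ P) (e ◅ Q) → P ≡ Q
  ◅-injective refl = refl

  second : ∀ {u} → Path u t → V
  second {u} ε           = u
  second (_◅_ {j = v} _ _) = v

  second-moveTo : ∀ k u v {P} → P ∈ moveTo k u v → second P ≡ v
  second-moveTo k u v P∈ with T? (adj u v)
  ... | yes e with _ , _ , refl ← ∈-map⁻ (e ◅_) P∈ = refl

  mutual
    trajectories-unique : ∀ k u → Unique (trajectories k u)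
    trajectories-unique k u with u Fin.≟ t
    ... | yes refl = [] ∷ []
    ... | no  _    = moves-unique k u

    moves-unique : ∀ k u → Unique (moves k u)
    moves-unique zero    u = []
    moves-unique (suc k) u = Unique.concat⁺
      (All.map⁺ (All.tabulate λ {v} _ → moveTo-unique k u v))
      (AllPairs.map⁺ (AllPairs.map disjoint (Unique.allFin⁺ n)))
      where
      disjoint : ∀ {v v′} → v ≢ v′ → Disjoint (moveTo k u v) (moveTo k u v′)
      disjoint {v} {v′} v≢v′ {P} (P∈ , P∈′)
        with refl ← second-moveTo k u v {P} P∈ = v≢v′ (second-moveTo k u v′ {P} P∈′)

    moveTo-unique : ∀ k u v → Unique (moveTo k u v)
    moveTo-unique k u v with T? (adj u v)
    ... | yes e = Unique.map⁺ ◅-injective (trajectories-unique k v)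
    ... | no  _ = []

  outcomes-complete : (P : Path s t) → P ∈ outcomes
  outcomes-complete P = ∈-trajectories P (ℕ.<⇒≤ (arcs<n P))

  outcomes-unique : Unique outcomes
  outcomes-unique = trajectories-unique n s

  distance-≤ : (P : Path s t) → distance ℕ.≤ cost P
  distance-≤ P = min≤v⁺ (cost reachable) (map cost outcomes) (inj₂
    (Any.map (λ eq → ℕ.≤-reflexive (sym eq)) (∈-map⁺ cost (outcomes-complete P))))

  distance-attained : ∃ λ (P : Path s t) → cost P ≡ distance
  distance-attained with argmin-sel id (cost reachable) (map cost outcomes)
  ... | inj₁ eq = reachable , sym eq
  ... | inj₂ ∈costs with P , _ , eq ← ∈-map⁻ cost ∈costs = P , sym eq

-- A real RAM, presented as a while language.  There are two memories, one
-- holding natural numbers (used as indices) and one holding elements of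
-- the ordered field.  Each consists of two-dimensional arrays; a scalar x
-- is the cell x[0,0].  Each operation has unit cost.  Index
-- arithmetic has no multiplication, and field elements cannot be converted
-- to indices.

Name : Set
Name = ℕ

infixl 6 _+ᵢ_ _∸ᵢ_ _+ₙ_ _-ₙ_
infixl 7 _*ₙ_ _/ₙ_
infix  4 _≤ᵢ_ _≤ₙ_

data IndexExp : Set where
  lit       : ℕ → IndexExp
  _[_,_]ᵢ   : Name → IndexExp → IndexExp → IndexExp
  _+ᵢ_ _∸ᵢ_ : IndexExp → IndexExp → IndexExp

data NumExp : Set where
  0ₙ 1ₙ               : NumExp
  _[_,_]ₙ             : Name → IndexExp → IndexExp → NumExp
  _+ₙ_ _-ₙ_ _*ₙ_ _/ₙ_ : NumExp → NumExp → NumExp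

data Test : Set where
  _≤ᵢ_ : IndexExp → IndexExp → Test
  _≤ₙ_ : NumExp → NumExp → Test
  notₜ : Test → Test
  _∧ₜ_ : Test → Test → Test

infix  3 _[_,_]:=ᵢ_ _[_,_]:=ₙ_
infixr 2 _⨾_

data Program : Set where
  skip         : Program
  _[_,_]:=ᵢ_   : Name → IndexExp → IndexExp → IndexExp → Program
  _[_,_]:=ₙ_   : Name → IndexExp → IndexExp → NumExp → Program
  _⨾_          : Program → Program → Program
  ifₚ_then_else_ : Test → Program → Program → Program
  while_loop_    : Test → Program → Program

costᵢ : IndexExp → ℕ
costᵢ (lit _)        = 1
costᵢ (_ [ i , j ]ᵢ) = 1 ℕ.+ costᵢ i ℕ.+ costᵢ j
costᵢ (a +ᵢ b)       = 1 ℕ.+ costᵢ a ℕ.+ costᵢ b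
costᵢ (a ∸ᵢ b)       = 1 ℕ.+ costᵢ a ℕ.+ costᵢ b

costₙ : NumExp → ℕ
costₙ 0ₙ             = 1
costₙ 1ₙ             = 1
costₙ (_ [ i , j ]ₙ) = 1 ℕ.+ costᵢ i ℕ.+ costᵢ j
costₙ (a +ₙ b)       = 1 ℕ.+ costₙ a ℕ.+ costₙ b
costₙ (a -ₙ b)       = 1 ℕ.+ costₙ a ℕ.+ costₙ b
costₙ (a *ₙ b)       = 1 ℕ.+ costₙ a ℕ.+ costₙ b
costₙ (a /ₙ b)       = 1 ℕ.+ costₙ a ℕ.+ costₙ b

costₜ : Test → ℕ
costₜ (a ≤ᵢ b) = 1 ℕ.+ costᵢ a ℕ.+ costᵢ b
costₜ (a ≤ₙ b) = 1 ℕ.+ costₙ a ℕ.+ costₙ b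
costₜ (notₜ b) = 1 ℕ.+ costₜ b
costₜ (a ∧ₜ b) = 1 ℕ.+ costₜ a ℕ.+ costₜ b

Memory : ∀ {a} → Set a → Set a
Memory A = Name → ℕ → ℕ → A

write : ∀ {a} {A : Set a} → Memory A → Name → ℕ → ℕ → A → Memory A
write m x i j a y k l = if (x ≡ᵇ y) ∧ (i ≡ᵇ k) ∧ (j ≡ᵇ l) then a else m y k l

module _ {c ℓ₁ ℓ₂} (K : OrderedField c ℓ₁ ℓ₂) where
  private
    module K = OrderedField K

  record Store : Set c where
    constructor ⟨_,_⟩
    field
      index : Memory ℕ
      num   : Memory K.Carrier

  open Store

  evalᵢ : Store → IndexExp → ℕ
  evalᵢ σ (lit k)        = k
  evalᵢ σ (x [ i , j ]ᵢ) = index σ x (evalᵢ σ i) (evalᵢ σ j)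
  evalᵢ σ (a +ᵢ b)       = evalᵢ σ a ℕ.+ evalᵢ σ b
  evalᵢ σ (a ∸ᵢ b)       = evalᵢ σ a ℕ.∸ evalᵢ σ b

  evalₙ : Store → NumExp → K.Carrier
  evalₙ σ 0ₙ             = K.0#
  evalₙ σ 1ₙ             = K.1#
  evalₙ σ (x [ i , j ]ₙ) = num σ x (evalᵢ σ i) (evalᵢ σ j)
  evalₙ σ (a +ₙ b)       = evalₙ σ a K.+ evalₙ σ b
  evalₙ σ (a -ₙ b)       = evalₙ σ a K.- evalₙ σ b
  evalₙ σ (a *ₙ b)       = evalₙ σ a K.* evalₙ σ b
  evalₙ σ (a /ₙ b)       = evalₙ σ a K./ evalₙ σ b

  evalₜ : Store → Test → Bool
  evalₜ σ (a ≤ᵢ b) = evalᵢ σ a ≤ᵇ evalᵢ σ b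
  evalₜ σ (a ≤ₙ b) = does (evalₙ σ a K.≤? evalₙ σ b)
  evalₜ σ (notₜ b) = not (evalₜ σ b)
  evalₜ σ (a ∧ₜ b) = evalₜ σ a ∧ evalₜ σ b

  -- Exec P σ k σ′: run from σ, the program P halts in σ′ after k steps.
  data Exec : Program → Store → ℕ → Store → Set c where
    skip    : ∀ {σ} → Exec skip σ 1 σ
    assignᵢ : ∀ {σ x i j e} →
              Exec (x [ i , j ]:=ᵢ e) σ (1 ℕ.+ costᵢ i ℕ.+ costᵢ j ℕ.+ costᵢ e)
                   ⟨ write (index σ) x (evalᵢ σ i) (evalᵢ σ j) (evalᵢ σ e) , num σ ⟩
    assignₙ : ∀ {σ x i j e} →
              Exec (x [ i , j ]:=ₙ e) σ (1 ℕ.+ costᵢ i ℕ.+ costᵢ j ℕ.+ costₙ e)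
                   ⟨ index σ , write (num σ) x (evalᵢ σ i) (evalᵢ σ j) (evalₙ σ e) ⟩
    seq     : ∀ {σ σ′ σ″ P Q k l} →
              Exec P σ k σ′ → Exec Q σ′ l σ″ → Exec (P ⨾ Q) σ (k ℕ.+ l) σ″
    if-true : ∀ {σ σ′ b P Q k} → evalₜ σ b ≡ true →
              Exec P σ k σ′ → Exec (ifₚ b then P else Q) σ (1 ℕ.+ costₜ b ℕ.+ k) σ′
    if-false : ∀ {σ σ′ b P Q k} → evalₜ σ b ≡ false →
              Exec Q σ k σ′ → Exec (ifₚ b then P else Q) σ (1 ℕ.+ costₜ b ℕ.+ k) σ′
    while-true : ∀ {σ σ′ σ″ b P k l} → evalₜ σ b ≡ true →
              Exec P σ k σ′ → Exec (while b loop P) σ′ l σ″ →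
              Exec (while b loop P) σ (1 ℕ.+ costₜ b ℕ.+ k ℕ.+ l) σ″
    while-false : ∀ {σ b P} → evalₜ σ b ≡ false →
              Exec (while b loop P) σ (1 ℕ.+ costₜ b) σ

module _ {c ℓ₁ ℓ₂} {K : OrderedField c ℓ₁ ℓ₂} (M : Model K) where
  open OrderedField K using (Carrier; 0#; fromℕ)
  open Model M

  pad : ∀ {a} {A : Set a} → A → (V → V → A) → ℕ → ℕ → A
  pad default f i j with i ℕ.<? n | j ℕ.<? n
  ... | yes i<n | yes j<n = f (fromℕ< i<n) (fromℕ< j<n)
  ... | _       | _       = default

  -- Indices: n, s, t and the adjacency matrix in arrays 0-3.  Numbers: β and
  -- the matrices of w and p in arrays 0-2, with 0 at non-arcs.  Results are
  -- expected in number cells 3[0,0] and 4[0,0].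
  input : Store K
  input = ⟨ index₀ , num₀ ⟩
    where
    index₀ : Memory ℕ
    index₀ 0 0 0 = n
    index₀ 1 0 0 = toℕ s
    index₀ 2 0 0 = toℕ t
    index₀ 3 i j = pad 0 (λ u v → if adj u v then 1 else 0) i j
    index₀ _ _ _ = 0

    num₀ : Memory Carrier
    num₀ 0 0 0 = β
    num₀ 1 i j = pad 0# (arcMatrix 0# (λ e → fromℕ (w e))) i j
    num₀ 2 i j = pad 0# (arcMatrix 0# p) i j
    num₀ _ _ _ = 0#

output₁ output₂ : ∀ {c ℓ₁ ℓ₂} {K : OrderedField c ℓ₁ ℓ₂} → Store K → OrderedField.Carrier K
output₁ σ = Store.num σ 3 0 0
output₂ σ = Store.num σ 4 0 0

{-# OPTIONS --safe #-}
module Submission where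

-- The agent's trajectories of at most k + 1 arcs from u ≠ t are the arcs uv
-- followed by a trajectory of at most k arcs from v.  Hence the total
-- probability A, the sums B and C of probability · cost and
-- probability · cost², and the least cost of these trajectories are obtained
-- from those at the successors of u with O(1) operations per arc, and n rounds
-- of this recursion over all pairs (u, v) cover every trajectory.  With
-- δ = 1 / d(s,t) and μ = − δ B at s, the results are E(X) = δ B and
-- Var(X) = μ² A + 2 μ δ B + δ² C.

open import Algebra.Bundles using (CommutativeRing)
import Algebra.Properties.Monoid.Mult as Mult
import Algebra.Properties.Ring as RingProperties
import Algebra.Solver.Ring.NaturalCoefficients.Default as SemiringSolver
open import Data.Bool.Base using (true; false; _∧_; if_then_else_)
open import Data.Bool.Properties using (T?; T-irrelevant; T-≡; T-∧; ∧-zeroʳ)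
open import Data.Fin.Base as Fin using (Fin; toℕ; fromℕ<)
import Data.Fin.Properties as Fin
open import Data.List.Base using (List; []; _∷_; _++_; map; concatMap; allFin; take)
open import Data.List.Membership.Propositional using (_∈_)
open import Data.List.Membership.Propositional.Properties using (∈-++⁺ˡ; ∈-++⁺ʳ; ∈-map⁺)
import Data.List.Properties as List
open import Data.List.Relation.Unary.All as All using (All; []; _∷_)
import Data.List.Relation.Unary.All.Properties as All
open import Data.List.Relation.Unary.Any using (here)
open import Data.Nat.Base as ℕ using (ℕ; zero; suc; _*_; _^_; _≤_; _<_; _≡ᵇ_; _≤ᵇ_; _⊔_; NonZero; z≤n; s≤s)
import Data.Nat.Properties as ℕ
open import Data.Product.Base using (∃; Σ-syntax; _×_; _,_; proj₁; proj₂)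
open import Data.Sum.Base using (inj₁; inj₂)
open import Function.Base using (id; _∘_)
open import Function.Bundles using (Equivalence)
open import Level using (Level)
open import Relation.Binary.Construct.Closure.ReflexiveTransitive using (ε; _◅_)
open import Relation.Binary.PropositionalEquality as ≡ using (_≡_; _≢_; refl; cong; cong₂; subst)
open import Relation.Binary.Structures using (IsDecTotalOrder)
import Relation.Binary.Reasoning.Setoid as SetoidReasoning
open import Relation.Nullary using (¬_; does; yes; no; contradiction)
open import Relation.Nullary.Decidable using (dec-true; dec-false)
open import Defs

-- Running time as a polynomial in the loop bound.

-- Bounds the running time, provided that every loop makes at most N iterations
-- each time it is entered.
time : ℕ → Program → ℕ
time N skip                     = 1
time N (_ [ i , j ]:=ᵢ e)       = 1 ℕ.+ costᵢ i ℕ.+ costᵢ j ℕ.+ costᵢ e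
time N (_ [ i , j ]:=ₙ e)       = 1 ℕ.+ costᵢ i ℕ.+ costᵢ j ℕ.+ costₙ e
time N (P ⨾ Q)                  = time N P ℕ.+ time N Q
time N (ifₚ b then P else Q)    = 1 ℕ.+ costₜ b ℕ.+ (time N P ⊔ time N Q)
time N (while b loop P)         = N * (1 ℕ.+ costₜ b ℕ.+ time N P) ℕ.+ (1 ℕ.+ costₜ b)

depth : Program → ℕ
depth skip                  = 0
depth (_ [ _ , _ ]:=ᵢ _)    = 0
depth (_ [ _ , _ ]:=ₙ _)    = 0
depth (P ⨾ Q)               = depth P ⊔ depth Q
depth (ifₚ _ then P else Q) = depth P ⊔ depth Q
depth (while _ loop P)      = suc (depth P)

module _ (N : ℕ) .{{_ : NonZero N}} where
  private
    scale : ∀ a d {m b e} → m ≤ a * N ^ d → a ≤ b → d ≤ e → m ≤ b * N ^ e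
    scale a d m≤ a≤b d≤e = ℕ.≤-trans m≤ (ℕ.*-mono-≤ a≤b (ℕ.^-monoʳ-≤ N d≤e))

    constant : ∀ a d → a ≤ a * N ^ d
    constant a d = ℕ.m≤m*n a (N ^ d) {{ℕ.m^n≢0 N d}}

    add : ∀ {m m′} a a′ d → m ≤ a * N ^ d → m′ ≤ a′ * N ^ d → m ℕ.+ m′ ≤ (a ℕ.+ a′) * N ^ d
    add a a′ d m≤ m′≤ = ℕ.≤-trans (ℕ.+-mono-≤ m≤ m′≤)
                              (ℕ.≤-reflexive (≡.sym (ℕ.*-distribʳ-+ (N ^ d) a a′)))

  -- Induction on `P`. At `N = 1` all powers of `N` are 1, so `time 1 P` collects the coefficients;
  -- since `N` is non-zero, every lower power is at most `N ^ depth P`.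
  time-polynomial : ∀ P → time N P ≤ time 1 P * N ^ depth P
  time-polynomial skip               = constant 1 0
  time-polynomial (_ [ i , j ]:=ᵢ e) = constant (1 ℕ.+ costᵢ i ℕ.+ costᵢ j ℕ.+ costᵢ e) 0
  time-polynomial (_ [ i , j ]:=ₙ e) = constant (1 ℕ.+ costᵢ i ℕ.+ costᵢ j ℕ.+ costₙ e) 0
  time-polynomial (P ⨾ Q) = add (time 1 P) (time 1 Q) (depth P ⊔ depth Q)
    (scale (time 1 P) (depth P) (time-polynomial P) ℕ.≤-refl (ℕ.m≤m⊔n _ _))
    (scale (time 1 Q) (depth Q) (time-polynomial Q) ℕ.≤-refl (ℕ.m≤n⊔m (depth P) _))
  time-polynomial (ifₚ b then P else Q) =
    add (1 ℕ.+ costₜ b) (time 1 P ⊔ time 1 Q) (depth P ⊔ depth Q)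
      (constant (1 ℕ.+ costₜ b) (depth P ⊔ depth Q))
      (ℕ.⊔-lub
        (scale (time 1 P) (depth P) (time-polynomial P) (ℕ.m≤m⊔n _ _) (ℕ.m≤m⊔n _ _))
        (scale (time 1 Q) (depth Q) (time-polynomial Q)
          (ℕ.m≤n⊔m (time 1 P) _) (ℕ.m≤n⊔m (depth P) _)))
  time-polynomial (while b loop P) =
    -- The factor `1` is what `time 1` unfolds to at a loop, so the coefficients agree
    -- definitionally.
    add (1 * (τ ℕ.+ time 1 P)) τ (suc d) iterations (constant τ (suc d))
    where
    τ d : ℕ
    τ = 1 ℕ.+ costₜ b
    d = depth P

    open ℕ.≤-Reasoning

    iterations : N * (τ ℕ.+ time N P) ≤ 1 * (τ ℕ.+ time 1 P) * (N * N ^ d)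
    iterations = begin
      N * (τ ℕ.+ time N P)
        ≤⟨ ℕ.*-monoʳ-≤ N (add τ (time 1 P) d (constant τ d) (time-polynomial P)) ⟩
      N * ((τ ℕ.+ time 1 P) * N ^ d)       ≡⟨ ℕ.*-assoc N (τ ℕ.+ time 1 P) (N ^ d) ⟨
      N * (τ ℕ.+ time 1 P) * N ^ d         ≡⟨ cong (_* N ^ d) (ℕ.*-comm N (τ ℕ.+ time 1 P)) ⟩
      (τ ℕ.+ time 1 P) * N * N ^ d         ≡⟨ ℕ.*-assoc (τ ℕ.+ time 1 P) N (N ^ d) ⟩
      (τ ℕ.+ time 1 P) * (N * N ^ d)       ≡⟨ cong (_* (N * N ^ d)) (ℕ.*-identityˡ (τ ℕ.+ time 1 P)) ⟨
      1 * (τ ℕ.+ time 1 P) * (N * N ^ d)   ∎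

-- Scalar cells, counted loops and index tests.

scalarᵢ : Name → IndexExp
scalarᵢ x = x [ lit 0 , lit 0 ]ᵢ

scalarₙ : Name → NumExp
scalarₙ x = x [ lit 0 , lit 0 ]ₙ

infix 3 _:=ᵢ_ _:=ₙ_

_:=ᵢ_ : Name → IndexExp → Program
x :=ᵢ e = x [ lit 0 , lit 0 ]:=ᵢ e

_:=ₙ_ : Name → NumExp → Program
x :=ₙ e = x [ lit 0 , lit 0 ]:=ₙ e

-- Index cell 0 holds n.
below : Name → Test
below x = lit 1 +ᵢ scalarᵢ x ≤ᵢ scalarᵢ 0

for_loop_ : Name → Program → Program
for x loop P = x :=ᵢ lit 0 ⨾ (while below x loop (P ⨾ x :=ᵢ lit 1 +ᵢ scalarᵢ x))

≤ᵇ-true : ∀ {m n} → m ≤ n → (m ≤ᵇ n) ≡ true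
≤ᵇ-true {m} {n} = dec-true (m ℕ.≤? n)

≤ᵇ-false : ∀ {m n} → ¬ m ≤ n → (m ≤ᵇ n) ≡ false
≤ᵇ-false {m} {n} = dec-false (m ℕ.≤? n)

≡ᵇ-false : ∀ {m n} → m ≢ n → (m ≡ᵇ n) ≡ false
≡ᵇ-false {m} {n} = dec-false (m ℕ.≟ n)

≡ᵇ-true : ∀ m → (m ≡ᵇ m) ≡ true
≡ᵇ-true m = dec-true (m ℕ.≟ m) refl

≤ᵇ-antisym : ∀ {m n} → (m ≤ᵇ n) ∧ (n ≤ᵇ m) ≡ true → m ≡ n
≤ᵇ-antisym {m} {n} eq with m≤n , n≤m ← Equivalence.to T-∧ (Equivalence.from T-≡ eq) =
  ℕ.≤-antisym (ℕ.≤ᵇ⇒≤ m n m≤n) (ℕ.≤ᵇ⇒≤ n m n≤m)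

≤ᵇ-∧-refl : ∀ m → (m ≤ᵇ m) ∧ (m ≤ᵇ m) ≡ true
≤ᵇ-∧-refl m = cong₂ _∧_ (≤ᵇ-true {m} ℕ.≤-refl) (≤ᵇ-true {m} ℕ.≤-refl)

-- Total correctness with time bounds.

module Execution {c ℓ₁ ℓ₂} (K : OrderedField c ℓ₁ ℓ₂) (N : ℕ) where
  open Store {K = K}

  -- The time bound depends on `P` and `N` alone, so the rules below compose it silently. `run-⨾`
  -- puts the rest of a program into the postcondition: straight-line code is verified on the store
  -- obtained by evaluating its writes.
  record Runs {ℓ} (P : Program) (σ : Store K) (Post : Store K → Set ℓ) : Set (c Level.⊔ ℓ) where
    constructor runs
    field
      {steps} : ℕ
      {final} : Store K
      exec    : Exec K P σ steps final
      bounded : steps ≤ time N P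
      post    : Post final

  module _ {ℓ} {Post : Store K → Set ℓ} where

    run-skip : ∀ {σ} → Post σ → Runs skip σ Post
    run-skip = runs skip ℕ.≤-refl

    run-:=ᵢ : ∀ {σ x i j e} →
      Post ⟨ write (index σ) x (evalᵢ K σ i) (evalᵢ K σ j) (evalᵢ K σ e) , num σ ⟩ →
      Runs (x [ i , j ]:=ᵢ e) σ Post
    run-:=ᵢ = runs assignᵢ ℕ.≤-refl

    run-:=ₙ : ∀ {σ x i j e} →
      Post ⟨ index σ , write (num σ) x (evalᵢ K σ i) (evalᵢ K σ j) (evalₙ K σ e) ⟩ →
      Runs (x [ i , j ]:=ₙ e) σ Post
    run-:=ₙ = runs assignₙ ℕ.≤-refl

    run-⨾ : ∀ {σ P Q} → Runs P σ (λ σ′ → Runs Q σ′ Post) → Runs (P ⨾ Q) σ Post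
    run-⨾ (runs e₁ b₁ (runs e₂ b₂ p)) = runs (seq e₁ e₂) (ℕ.+-mono-≤ b₁ b₂) p

    run-if : ∀ {σ b P Q} → (evalₜ K σ b ≡ true → Runs P σ Post) →
             (evalₜ K σ b ≡ false → Runs Q σ Post) → Runs (ifₚ b then P else Q) σ Post
    run-if {σ} {b} {P} {Q} yes′ no′ with evalₜ K σ b in eq
    ... | true  with runs e le p ← yes′ refl =
      runs (if-true eq e) (ℕ.+-monoʳ-≤ (1 ℕ.+ costₜ b) (ℕ.≤-trans le (ℕ.m≤m⊔n _ _))) p
    ... | false with runs e le p ← no′ refl =
      runs (if-false eq e) (ℕ.+-monoʳ-≤ (1 ℕ.+ costₜ b) (ℕ.≤-trans le (ℕ.m≤n⊔m (time N P) _))) p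

    run-weaken : ∀ {ℓ′} {Pre : Store K → Set ℓ′} {σ P} →
                 (∀ {σ′} → Pre σ′ → Post σ′) → Runs P σ Pre → Runs P σ Post
    run-weaken f (runs e le p) = runs e le (f p)

  increment : Store K → Name → Store K
  increment σ x = ⟨ write (index σ) x 0 0 (suc (index σ x 0 0)) , num σ ⟩

  -- The invariant itself yields the loop bound and the counter, which decides the loop test at
  -- every `j`; hence exactly `N` iterations occur.
  run-for : ∀ {ℓ} (I : ℕ → Store K → Set ℓ) {x P σ} →
            (∀ {j σ} → I j σ → index σ 0 0 0 ≡ N) →
            (∀ {j σ} → I j σ → index σ x 0 0 ≡ j) →
            (∀ {j σ} → j < N → I j σ → Runs P σ (λ σ′ → I (suc j) (increment σ′ x))) →
            I 0 ⟨ write (index σ) x 0 0 0 , num σ ⟩ →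
            Runs (for x loop P) σ (I N)
  run-for I {x} {P} bound counter body init =
    run-⨾ (run-:=ᵢ (whole init))
    where
    τ : ℕ
    τ = 1 ℕ.+ costₜ (below x)

    R : Program
    R = P ⨾ x :=ᵢ lit 1 +ᵢ scalarᵢ x

    -- `r` counts the iterations left; recursion on it gives both termination and the step bound.
    iterate : ∀ r {j σ} → r ℕ.+ j ≡ N → I j σ →
              ∃ λ k → ∃ λ σ′ → Exec K (while below x loop R) σ k σ′ ×
                k ≤ r * (τ ℕ.+ time N R) ℕ.+ τ × I N σ′
    iterate zero {σ = σ} refl inv = _ , σ , while-false stop , ℕ.≤-refl , inv
      where
      stop : evalₜ K σ (below x) ≡ false
      stop rewrite bound inv | counter inv = ≤ᵇ-false {suc N} {N} (ℕ.<-irrefl refl)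
    iterate (suc r) {j} {σ} eq inv
      with j<N ← subst (j <_) eq (s≤s (ℕ.m≤n+m j r))
      with runs e le inv′ ← body j<N inv
      with k , σ′ , e′ , le′ , inv″ ← iterate r (≡.trans (ℕ.+-suc r j) eq) inv′ =
      _ , σ′ , while-true go (seq e assignᵢ) e′ ,
      ℕ.≤-trans (ℕ.+-mono-≤ (ℕ.+-monoʳ-≤ τ (ℕ.+-monoˡ-≤ _ le)) le′)
        (ℕ.≤-reflexive (≡.sym (ℕ.+-assoc (τ ℕ.+ time N R) (r * (τ ℕ.+ time N R)) τ))) ,
      inv″
      where
      go : evalₜ K σ (below x) ≡ true
      go rewrite bound inv | counter inv = ≤ᵇ-true {suc j} {N} (subst (j <_) eq (s≤s (ℕ.m≤n+m j r)))

    whole : ∀ {σ} → I 0 σ → Runs (while below x loop R) σ (I N)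
    whole inv with _ , _ , e , le , p ← iterate N (ℕ.+-identityʳ N) inv = runs e le p

-- Order and finite sums in an ordered field.

module OrderedFieldProperties {c ℓ₁ ℓ₂} (K : OrderedField c ℓ₁ ℓ₂) where
  open OrderedField K hiding (_-_) renaming (_≤_ to _≤#_; _*_ to _·_)
  open CommutativeRing commutativeRing public
    using ( setoid; ring; commutativeSemiring; +-monoid; +-cong; +-congˡ; -‿cong; *-cong; *-congˡ
          ; +-identityˡ; +-identityʳ; +-assoc; -‿inverseʳ; *-identityˡ)
    renaming (refl to ≈-refl; sym to ≈-sym; trans to ≈-trans; reflexive to ≈-reflexive)
  open IsDecTotalOrder isDecTotalOrder public
    using (total; antisym) renaming (refl to ≤-refl; reflexive to ≤-reflexive; trans to ≤-trans)

  -- If `1# ≤ 0#`, then `- 1#` is non-negative, and so is its square `1#`.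
  0≤1 : 0# ≤# 1#
  0≤1 with total 0# 1#
  ... | inj₁ 0≤1 = 0≤1
  ... | inj₂ 1≤0 = ≤-trans (*-nonneg 0≤-1 0≤-1) (≤-reflexive [-1]²≈1)
    where
    open RingProperties ring using (-‿distribˡ-*; -‿distribʳ-*; -‿involutive)
    open SetoidReasoning setoid

    0≤-1 : 0# ≤# - 1#
    0≤-1 = ≤-trans (≤-reflexive (≈-sym (-‿inverseʳ 1#)))
      (≤-trans (+-mono-≤ 1≤0 ≤-refl) (≤-reflexive (+-identityˡ (- 1#))))

    [-1]²≈1 : - 1# · - 1# ≈ 1#
    [-1]²≈1 = begin
      - 1# · - 1#     ≈⟨ -‿distribˡ-* 1# (- 1#) ⟨
      - (1# · - 1#)   ≈⟨ -‿cong (*-identityˡ (- 1#)) ⟩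
      - (- 1#)        ≈⟨ -‿involutive 1# ⟩
      1#              ∎

  fromℕ-homo-+ : ∀ m k → fromℕ (m ℕ.+ k) ≈ fromℕ m + fromℕ k
  fromℕ-homo-+ = Mult.×-homo-+ +-monoid 1#

  fromℕ-mono-≤ : ∀ {m k} → m ≤ k → fromℕ m ≤# fromℕ k
  fromℕ-mono-≤ {k = zero}  z≤n       = ≤-refl
  fromℕ-mono-≤ {k = suc k} z≤n       =
    ≤-trans (≤-reflexive (≈-sym (+-identityˡ 0#))) (+-mono-≤ 0≤1 (fromℕ-mono-≤ {k = k} z≤n))
  fromℕ-mono-≤             (s≤s m≤k) = +-mono-≤ ≤-refl (fromℕ-mono-≤ m≤k)

  module _ {a} {A : Set a} where

    sumOver-++ : ∀ (xs ys : List A) f → sumOver (xs ++ ys) f ≈ sumOver xs f + sumOver ys f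
    sumOver-++ []       ys f = ≈-sym (+-identityˡ _)
    sumOver-++ (x ∷ xs) ys f = ≈-trans (+-congˡ (sumOver-++ xs ys f)) (≈-sym (+-assoc _ _ _))

    sumOver-map : ∀ {b} {B : Set b} (g : B → A) ys f → sumOver (map g ys) f ≡ sumOver ys (f ∘ g)
    sumOver-map g []       f = refl
    sumOver-map g (y ∷ ys) f = cong (f (g y) +_) (sumOver-map g ys f)

    -- Three terms suit the application: probability times a quadratic in the cost is a combination
    -- of the moments of order 0, 1 and 2.
    sumOver-linear : ∀ (xs : List A) {f g h k} x y z →
      (∀ a → f a ≈ x · g a + (y · h a + z · k a)) →
      sumOver xs f ≈ x · sumOver xs g + (y · sumOver xs h + z · sumOver xs k)
    sumOver-linear []       x y z f≈ = solve 3 (λ x y z →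
      con 0 := x :* con 0 :+ (y :* con 0 :+ z :* con 0)) ≈-refl x y z
      where open SemiringSolver commutativeSemiring
    sumOver-linear (a ∷ xs) {f} {g} {h} {k} x y z f≈ =
      ≈-trans (+-cong (f≈ a) (sumOver-linear xs x y z f≈)) (solve 9
        (λ x y z g G h H k K →
          (x :* g :+ (y :* h :+ z :* k)) :+ (x :* G :+ (y :* H :+ z :* K)) :=
          x :* (g :+ G) :+ (y :* (h :+ H) :+ z :* (k :+ K))) ≈-refl
        x y z (g a) (sumOver xs g) (h a) (sumOver xs h) (k a) (sumOver xs k))
      where open SemiringSolver commutativeSemiring

-- Moments and least costs of lists of paths.

module Summaries {c ℓ₁ ℓ₂} {K : OrderedField c ℓ₁ ℓ₂} (M : Model K) where
  open OrderedField K renaming (_≤_ to _≤#_; _≤?_ to _≤#?_; _*_ to _·_)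
  open OrderedFieldProperties K
  open Model M

  private
    ℙ : ∀ {u} → Path u t → Carrier
    ℙ = probability M

    ∣_∣ : ∀ {u} → Path u t → Carrier
    ∣ P ∣ = fromℕ (cost P)

  record Moments {u} (xs : List (Path u t)) (a b c : Carrier) : Set ℓ₁ where
    field
      moment₀ : a ≈ sumOver xs ℙ
      moment₁ : b ≈ sumOver xs (λ P → ℙ P · ∣ P ∣)
      moment₂ : c ≈ sumOver xs (λ P → ℙ P · (∣ P ∣ · ∣ P ∣))

  open Moments

  -- Used for the shift of costs by one arc in `moments-◅`, and for the expectation and the variance
  -- in `run-report`.
  quadratic : ∀ {u} {xs : List (Path u t)} {a b c} → Moments xs a b c → ∀ {f} x y z →
    (∀ P → f P ≈ x · ℙ P + (y · (ℙ P · ∣ P ∣) + z · (ℙ P · (∣ P ∣ · ∣ P ∣)))) →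
    sumOver xs f ≈ x · a + (y · b + z · c)
  quadratic {xs = xs} μ x y z f≈ = ≈-trans (sumOver-linear xs x y z f≈)
    (≈-sym (+-cong (*-congˡ (moment₀ μ)) (+-cong (*-congˡ (moment₁ μ)) (*-congˡ (moment₂ μ)))))

  moments-[] : ∀ {u} → Moments {u} [] 0# 0# 0#
  moments-[] = record { moment₀ = ≈-refl ; moment₁ = ≈-refl ; moment₂ = ≈-refl }

  moments-ε : Moments (ε ∷ []) 1# 0# 0#
  moments-ε = record
    { moment₀ = ≈-sym (+-identityʳ 1#)
    ; moment₁ = solve 0 (con 0 := con 1 :* con 0 :+ con 0) ≈-refl
    ; moment₂ = solve 0 (con 0 := con 1 :* (con 0 :* con 0) :+ con 0) ≈-refl
    }
    where open SemiringSolver commutativeSemiring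

  -- Prefixing `e` multiplies probabilities by `π` and shifts costs by `ω`; expand `ω + x` and its
  -- square. The resulting terms have exactly the shape of the expressions assigned in `relax`, so
  -- they match its stores by evaluation.
  moments-◅ : ∀ {u v} (e : Arc u v) {xs ys a b c a′ b′ c′ ω π} → ω ≡ fromℕ (w e) → π ≡ p e →
    Moments xs a b c → Moments ys a′ b′ c′ →
    Moments (xs ++ map (e ◅_) ys) (a + π · a′) (b + π · (b′ + ω · a′))
      (c + π · (c′ + (ω + ω) · b′ + ω · ω · a′))
  moments-◅ {u} e {xs} {ys} {a′ = a′} {b′} {c′} {ω} {π} refl refl μ ν = record
    { moment₀ = extend ℙ π 0# 0# (moment₀ μ)
        (λ P → solve 3 (λ π q x → π :* q :=
                 π :* q :+ (con 0 :* (q :* x) :+ con 0 :* (q :* (x :* x)))) ≈-refl π (ℙ P) ∣ P ∣)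
        (solve 4 (λ π a b c → π :* a := π :* a :+ (con 0 :* b :+ con 0 :* c)) ≈-refl π a′ b′ c′)
    ; moment₁ = extend (λ P → ℙ P · ∣ P ∣) (π · ω) π 0# (moment₁ μ)
        (λ P → ≈-trans (*-congˡ (fromℕ-homo-+ (w e) (cost P)))
          (solve 4 (λ π ω q x → π :* q :* (ω :+ x) :=
            π :* ω :* q :+ (π :* (q :* x) :+ con 0 :* (q :* (x :* x)))) ≈-refl π ω (ℙ P) ∣ P ∣))
        (solve 5 (λ π ω a b c → π :* (b :+ ω :* a) := π :* ω :* a :+ (π :* b :+ con 0 :* c))
          ≈-refl π ω a′ b′ c′)
    ; moment₂ = extend (λ P → ℙ P · (∣ P ∣ · ∣ P ∣)) (π · (ω · ω)) (π · (ω + ω)) π (moment₂ μ)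
        (λ P → ≈-trans (*-congˡ (*-cong (fromℕ-homo-+ (w e) (cost P)) (fromℕ-homo-+ (w e) (cost P))))
          (solve 4 (λ π ω q x → π :* q :* ((ω :+ x) :* (ω :+ x)) :=
            π :* (ω :* ω) :* q :+ (π :* (ω :+ ω) :* (q :* x) :+ π :* (q :* (x :* x))))
            ≈-refl π ω (ℙ P) ∣ P ∣))
        (solve 5 (λ π ω a b c → π :* (c :+ (ω :+ ω) :* b :+ ω :* ω :* a) :=
          π :* (ω :* ω) :* a :+ (π :* (ω :+ ω) :* b :+ π :* c)) ≈-refl π ω a′ b′ c′)
    }
    where
    open SemiringSolver commutativeSemiring

    extend : ∀ (f : Path u t → Carrier) x y z {m m′} → m ≈ sumOver xs f →
      (∀ P → f (e ◅ P) ≈ x · ℙ P + (y · (ℙ P · ∣ P ∣) + z · (ℙ P · (∣ P ∣ · ∣ P ∣)))) →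
      m′ ≈ x · a′ + (y · b′ + z · c′) →
      m + m′ ≈ sumOver (xs ++ map (e ◅_) ys) f
    extend f x y z m≈ f≈ m′≈ = ≈-sym (≈-trans (sumOver-++ xs (map (e ◅_) ys) f)
      (+-cong (≈-sym m≈) (≈-trans (≈-reflexive (sumOver-map (e ◅_) ys f))
        (≈-trans (quadratic ν x y z f≈) (≈-sym m′≈)))))

  -- The last index is the reachability flag kept in the index memory. Under `none` the value `d` is
  -- unconstrained, so comparisons with it must be guarded by the flag.
  data Minimum {u} (xs : List (Path u t)) (d : Carrier) : ℕ → Set (ℓ₁ Level.⊔ ℓ₂) where
    none : xs ≡ [] → Minimum xs d 0
    some : ∀ P → P ∈ xs → d ≈ ∣ P ∣ → All (λ Q → d ≤# ∣ Q ∣) xs → Minimum xs d 1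

  minimum-∈ : ∀ {u} {xs : List (Path u t)} {d r P} → Minimum xs d r → P ∈ xs →
    ∃ λ (Q : Path u t) → d ≈ ∣ Q ∣ × All (λ R → d ≤# ∣ R ∣) xs
  minimum-∈ (none refl) ()
  minimum-∈ (some Q _ d≈ d≤) _ = Q , d≈ , d≤

  -- `reachable` lies in `outcomes`, so the list is non-empty and `d` is the cost of some path,
  -- hence at least `distance`. As a lower bound, `d` is at most the cost of a path attaining
  -- `distance`.
  minimum-distance : ∀ {r d} → Minimum (outcomes M) d r → d ≈ fromℕ (distance M)
  minimum-distance min with minimum-∈ min (outcomes-complete M reachable) | distance-attained M
  ... | Q , d≈ , d≤ | P , cost≡ = antisym
    (≤-trans (All.lookup d≤ (outcomes-complete M P)) (≤-reflexive (≈-reflexive (cong fromℕ cost≡))))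
    (≤-trans (fromℕ-mono-≤ (distance-≤ M Q)) (≤-reflexive (≈-sym d≈)))

  minimum-ε : Minimum (ε ∷ []) 0# 1
  minimum-ε = some ε (here refl) ≈-refl (≤-refl ∷ [])

  module _ {u v : V} (e : Arc u v) {xs : List (Path u t)} {ys : List (Path v t)}
           {r r′ : ℕ} {d d′ ω : Carrier} (ω≡ : ω ≡ fromℕ (w e)) where
    private
      tail-bound : ∀ {d′} → All (λ Q → d′ ≤# ∣ Q ∣) ys → All (λ Q → ω + d′ ≤# ∣ Q ∣) (map (e ◅_) ys)
      tail-bound d′≤ = All.map⁺ (All.map (λ {Q} le →
        ≤-trans (+-mono-≤ (≤-reflexive (≈-reflexive ω≡)) le)
                (≤-reflexive (≈-sym (fromℕ-homo-+ (w e) (cost Q))))) d′≤)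

    -- This lemma and the next two are the exits of `relax` at an arc: no trajectory from `v`, least
    -- cost kept, least cost replaced. Their Boolean premises are the evaluated tests of the
    -- program.
    minimum-unreachable : (1 ≤ᵇ r′) ≡ false → Minimum xs d r → Minimum ys d′ r′ →
      Minimum (xs ++ map (e ◅_) ys) d r
    minimum-unreachable _ m (none refl) = subst (λ zs → Minimum zs d r) (≡.sym (List.++-identityʳ xs)) m

    minimum-keep : (1 ≤ᵇ r′) ≡ true → (1 ≤ᵇ r) ∧ does (d ≤#? (ω + d′)) ≡ true →
      Minimum xs d r → Minimum ys d′ r′ → Minimum (xs ++ map (e ◅_) ys) d r
    minimum-keep _ test (some P P∈ d≈ d≤) (some _ _ _ d′≤) with d ≤#? (ω + d′)
    ... | yes le = some P (∈-++⁺ˡ P∈) d≈ (All.++⁺ d≤ (All.map (≤-trans le) (tail-bound d′≤)))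

    minimum-replace : (1 ≤ᵇ r′) ≡ true → (1 ≤ᵇ r) ∧ does (d ≤#? (ω + d′)) ≡ false →
      Minimum xs d r → Minimum ys d′ r′ → Minimum (xs ++ map (e ◅_) ys) (ω + d′) 1
    minimum-replace _ test m (some Q Q∈ d′≈ d′≤) =
      some (e ◅ Q) (∈-++⁺ʳ xs (∈-map⁺ (e ◅_) Q∈))
        (≈-trans (+-cong (≈-reflexive ω≡) d′≈) (≈-sym (fromℕ-homo-+ (w e) (cost Q))))
        (All.++⁺ (smaller m test) (tail-bound d′≤))
      where
      smaller : Minimum xs d r → (1 ≤ᵇ r) ∧ does (d ≤#? (ω + d′)) ≡ false →
                All (λ R → ω + d′ ≤# ∣ R ∣) xs
      smaller (none refl) _ = []
      smaller (some _ _ _ d≤) test with d ≤#? (ω + d′) | total d (ω + d′)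
      ... | no _   | inj₂ ge = All.map (≤-trans ge) d≤
      ... | no ≰   | inj₁ le = contradiction le ≰

-- The dynamic program over arc counts and vertices.

-- Besides the input, index arrays hold: 4, 5, 6 the loop counters k, u, v;
-- 7[k,u] whether t is reachable from u by at most k arcs.  Number arrays 5-7
-- hold at [k,u] the total probability and the first two moments of the cost
-- over trajectories k u, and 8[k,u] their least cost (junk if there are
-- none).  Number cells 9-12 and index cell 8 accumulate the entries at
-- [k+1,u].
relax : Program
relax =
  ifₚ (lit 1 ≤ᵢ 3 [ u , v ]ᵢ)
  then (11 :=ₙ scalarₙ 11 +ₙ π *ₙ (7 [ k , v ]ₙ +ₙ (ω +ₙ ω) *ₙ 6 [ k , v ]ₙ +ₙ ω *ₙ ω *ₙ 5 [ k , v ]ₙ)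
      ⨾ 10 :=ₙ scalarₙ 10 +ₙ π *ₙ (6 [ k , v ]ₙ +ₙ ω *ₙ 5 [ k , v ]ₙ)
      ⨾ 9 :=ₙ scalarₙ 9 +ₙ π *ₙ 5 [ k , v ]ₙ
      ⨾ (ifₚ (lit 1 ≤ᵢ 7 [ k , v ]ᵢ)
         -- Until a trajectory has been found, cell 12 holds only a placeholder; the flag in index
         -- cell 8 then forces a replacement.
         then (ifₚ ((lit 1 ≤ᵢ scalarᵢ 8) ∧ₜ (scalarₙ 12 ≤ₙ ω +ₙ 8 [ k , v ]ₙ))
               then skip
               else (12 :=ₙ ω +ₙ 8 [ k , v ]ₙ ⨾ 8 :=ᵢ lit 1))
         else skip))
  else skip
  where
  k u v : IndexExp
  k = scalarᵢ 4
  u = scalarᵢ 5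
  v = scalarᵢ 6

  ω π : NumExp
  ω = 1 [ u , v ]ₙ
  π = 2 [ u , v ]ₙ

accumulate : Program
accumulate =
  ifₚ ((scalarᵢ 5 ≤ᵢ scalarᵢ 2) ∧ₜ (scalarᵢ 2 ≤ᵢ scalarᵢ 5))
  -- The empty path has cost 0: cells 10, 11 and 12 keep the zeros written by `reset`.
  then (9 :=ₙ 1ₙ ⨾ 8 :=ᵢ lit 1)
  else (for 6 loop relax)

reset : Program → Program
reset P = 9 :=ₙ 0ₙ ⨾ 10 :=ₙ 0ₙ ⨾ 11 :=ₙ 0ₙ ⨾ 12 :=ₙ 0ₙ ⨾ 8 :=ᵢ lit 0 ⨾ P

save : Program
save = 5 [ k′ , u ]:=ₙ scalarₙ 9
     ⨾ 6 [ k′ , u ]:=ₙ scalarₙ 10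
     ⨾ 7 [ k′ , u ]:=ₙ scalarₙ 11
     ⨾ 8 [ k′ , u ]:=ₙ scalarₙ 12
     ⨾ 7 [ k′ , u ]:=ᵢ scalarᵢ 8
  where
  k′ u : IndexExp
  k′ = lit 1 +ᵢ scalarᵢ 4
  u  = scalarᵢ 5

fillRow : Program
fillRow = for 5 loop (reset (accumulate ⨾ save))

-- Cells 10 and 9 now hold δ and μ.
report : Program
report = 10 :=ₙ 1ₙ /ₙ 8 [ n , s ]ₙ
       ⨾ 3 :=ₙ scalarₙ 10 *ₙ 6 [ n , s ]ₙ
       ⨾ 9 :=ₙ 0ₙ -ₙ scalarₙ 3
       ⨾ 4 :=ₙ scalarₙ 9 *ₙ scalarₙ 9 *ₙ 5 [ n , s ]ₙ
             +ₙ ((scalarₙ 9 +ₙ scalarₙ 9) *ₙ scalarₙ 10 *ₙ 6 [ n , s ]ₙ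
                 +ₙ scalarₙ 10 *ₙ scalarₙ 10 *ₙ 7 [ n , s ]ₙ)
  where
  n s : IndexExp
  n = scalarᵢ 0
  s = scalarᵢ 1

-- The first two assignments set up row 0, where only `t` has a trajectory; the remaining entries
-- are zeros of `input`. The outer loop fills row `k + 1` from row `k`, so it ends with row `n`,
-- which `report` reads.
momentProgram : Program
momentProgram = 5 [ lit 0 , scalarᵢ 2 ]:=ₙ 1ₙ
              ⨾ 7 [ lit 0 , scalarᵢ 2 ]:=ᵢ lit 1
              ⨾ (for 4 loop fillRow)
              ⨾ report

-- Loop invariants and correctness of the results.

module Correctness {c ℓ₁ ℓ₂} {K : OrderedField c ℓ₁ ℓ₂} (M : Model K) where
  open OrderedField K renaming (_≤_ to _≤#_; _*_ to _·_; _<_ to _<#_)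
  open OrderedFieldProperties K
  open Model M
  open Summaries M
  open Execution K n
  open Store {K = K}

  arcMatrix-arc : ∀ {a} {A : Set a} {z : A} {f : ∀ {u v} → Arc u v → A} {u v} (e : Arc u v) →
                  arcMatrix z f u v ≡ f e
  arcMatrix-arc {f = f} {u} {v} e with T? (adj u v)
  ... | yes e′ = cong f (T-irrelevant e′ e)
  ... | no ¬e  = contradiction e ¬e

  pad-< : ∀ {a} {A : Set a} {z : A} {f : V → V → A} {i j} (i<n : i < n) (j<n : j < n) →
          pad M z f i j ≡ f (fromℕ< i<n) (fromℕ< j<n)
  pad-< {i = i} {j} i<n j<n with i ℕ.<? n | j ℕ.<? n
  ... | yes _  | yes _  = refl
  ... | yes _  | no ≮   = contradiction j<n ≮
  ... | no ≮   | _      = contradiction i<n ≮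

  moveTo-arc : ∀ {k u v} (e : Arc u v) → moveTo M k u v ≡ map (e ◅_) (trajectories M k v)
  moveTo-arc {u = u} {v} e with T? (adj u v)
  ... | yes e′ rewrite T-irrelevant e′ e = refl
  ... | no ¬e  = contradiction e ¬e

  moveTo-nonarc : ∀ {k u v} → ¬ Arc u v → moveTo M k u v ≡ []
  moveTo-nonarc {u = u} {v} ¬e with T? (adj u v)
  ... | yes e = contradiction e ¬e
  ... | no _  = refl

  -- The part of `moves M (suc k) u` gathered by the inner loop after `m` candidate successors.
  firstMoves : ℕ → (u : V) → ℕ → List (Path u t)
  firstMoves k u m = concatMap (moveTo M k u) (take m (allFin n))

  firstMoves-suc : ∀ k u {m} (m<n : m < n) →
    firstMoves k u (suc m) ≡ firstMoves k u m ++ moveTo M k u (fromℕ< m<n)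
  firstMoves-suc k u {m} m<n = begin
    firstMoves k u (suc m)
      ≡⟨ cong (concatMap (moveTo M k u)) prefix-suc ⟩
    concatMap (moveTo M k u) (take m (allFin n) ++ fromℕ< m<n ∷ [])
      ≡⟨ List.concatMap-++ (moveTo M k u) (take m (allFin n)) _ ⟩
    firstMoves k u m ++ (moveTo M k u (fromℕ< m<n) ++ [])
      ≡⟨ cong (firstMoves k u m ++_) (List.++-identityʳ _) ⟩
    firstMoves k u m ++ moveTo M k u (fromℕ< m<n) ∎
    where
    open ≡.≡-Reasoning

    prefix-suc : take (suc m) (allFin n) ≡ take m (allFin n) ++ fromℕ< m<n ∷ []
    prefix-suc = subst (λ i → take (suc i) (allFin n) ≡ take i (allFin n) ++ fromℕ< m<n ∷ [])
      (Fin.toℕ-fromℕ< m<n) (List.take-suc-tabulate id (fromℕ< m<n))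

  firstMoves-all : ∀ k u → firstMoves k u n ≡ moves M (suc k) u
  firstMoves-all k u = cong (concatMap (moveTo M k u))
    (List.take-all n (allFin n) (ℕ.≤-reflexive (List.length-tabulate id)))

  trajectories-moves : ∀ k {u} → u ≢ t → trajectories M k u ≡ moves M k u
  trajectories-moves k {u} u≢t with u Fin.≟ t
  ... | yes u≡t = contradiction u≡t u≢t
  ... | no _    = refl

  Summary : ∀ {u} → List (Path u t) → (a b c d : Carrier) → ℕ → Set (ℓ₁ Level.⊔ ℓ₂)
  Summary xs a b c d r = Moments xs a b c × Minimum xs d r

  summary-[] : ∀ {u} → Summary {u} [] 0# 0# 0# 0# 0
  summary-[] = moments-[] , none refl

  summary-t : ∀ k {u} → u ≡ t → Summary (trajectories M k u) 1# 0# 0# 0# 1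
  summary-t k {u} u≡t with u Fin.≟ t
  ... | yes refl = moments-ε , minimum-ε
  ... | no u≢t   = contradiction u≡t u≢t

  -- The arrays involved are never written, and comparisons of literal array names compute, so these
  -- facts pass through every assignment unchanged.
  Inputs : Store K → Set c
  Inputs σ = index σ 0 0 0 ≡ n × index σ 1 0 0 ≡ toℕ s × index σ 2 0 0 ≡ toℕ t
    × (∀ i j (i<n : i < n) (j<n : j < n) →
         index σ 3 i j ≡ (if adj (fromℕ< i<n) (fromℕ< j<n) then 1 else 0))
    × (∀ i j (i<n : i < n) (j<n : j < n) →
         num σ 1 i j ≡ arcMatrix 0# (λ e → fromℕ (w e)) (fromℕ< i<n) (fromℕ< j<n))
    × (∀ i j (i<n : i < n) (j<n : j < n) →
         num σ 2 i j ≡ arcMatrix 0# p (fromℕ< i<n) (fromℕ< j<n))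

  Entry : ∀ {u} → Store K → ℕ → ℕ → List (Path u t) → Set (ℓ₁ Level.⊔ ℓ₂)
  Entry σ k i xs =
    Summary xs (num σ 5 k i) (num σ 6 k i) (num σ 7 k i) (num σ 8 k i) (index σ 7 k i)

  Accumulator : ∀ {u} → Store K → List (Path u t) → Set (ℓ₁ Level.⊔ ℓ₂)
  Accumulator σ xs =
    Summary xs (num σ 9 0 0) (num σ 10 0 0) (num σ 11 0 0) (num σ 12 0 0) (index σ 8 0 0)

  Row : Store K → ℕ → ℕ → Set (ℓ₁ Level.⊔ ℓ₂)
  Row σ k m = ∀ i (i<n : i < n) → i < m → Entry σ k i (trajectories M k (fromℕ< i<n))

  RowsDone : ℕ → Store K → Set (c Level.⊔ ℓ₁ Level.⊔ ℓ₂)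
  RowsDone k σ = Inputs σ × index σ 4 0 0 ≡ k × Row σ k n

  RowPartial : ℕ → ℕ → Store K → Set (c Level.⊔ ℓ₁ Level.⊔ ℓ₂)
  RowPartial k u σ = RowsDone k σ × index σ 5 0 0 ≡ u × Row σ (suc k) u

  Accumulating : ∀ {x} → ℕ → ℕ → List (Path x t) → Store K → Set (c Level.⊔ ℓ₁ Level.⊔ ℓ₂)
  Accumulating k u xs σ = RowPartial k u σ × Accumulator σ xs

  Relaxing : ∀ k {u} → u < n → ℕ → Store K → Set (c Level.⊔ ℓ₁ Level.⊔ ℓ₂)
  Relaxing k {u} u<n v σ =
    index σ 6 0 0 ≡ v × Accumulating k u (firstMoves k (fromℕ< u<n) v) σ

  flag : ∀ b → (1 ≤ᵇ (if b then 1 else 0)) ≡ b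
  flag true  = refl
  flag false = refl

  -- Matching the counter equations with `refl` identifies `k`, `u` and `v` with the cells that hold
  -- them, so the invariant applies to every address the code evaluates. A non-arc appends the empty
  -- list.
  run-relax : ∀ {k u v σ} (u<n : u < n) → v < n → Relaxing k u<n v σ →
              Runs relax σ (λ σ′ → Relaxing k u<n (suc v) (increment σ′ 6))
  run-relax {σ = σ} u<n v<n
    (refl , (((inputs@(_ , _ , _ , adj≡ , w≡ , p≡) , refl , row) , refl , row′) , μ , m)) =
    run-if arc (λ test → run-skip
      (refl , ctx , subst (Accumulator σ) (≡.sym (nonarc test)) (μ , m)))
    where
    ctx = (inputs , refl , row) , refl , row′
    m′ = proj₂ (row _ v<n v<n)
    k = index σ 4 0 0
    U = fromℕ< u<n
    W = fromℕ< v<n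

    test≡adj : (1 ≤ᵇ index σ 3 (index σ 5 0 0) (index σ 6 0 0)) ≡ adj U W
    test≡adj = ≡.trans (cong (1 ≤ᵇ_) (adj≡ _ _ u<n v<n)) (flag (adj U W))

    nonarc : (1 ≤ᵇ index σ 3 (index σ 5 0 0) (index σ 6 0 0)) ≡ false →
             firstMoves k U (suc (index σ 6 0 0)) ≡ firstMoves k U (index σ 6 0 0)
    nonarc test = ≡.trans (firstMoves-suc k U v<n)
        (≡.trans (cong (firstMoves k U (index σ 6 0 0) ++_) (moveTo-nonarc ¬e)) (List.++-identityʳ _))
      where
      ¬e : ¬ Arc U W
      ¬e e with () ← ≡.trans (≡.sym test) (≡.trans test≡adj (Equivalence.to T-≡ e))

    module _ (test : (1 ≤ᵇ index σ 3 (index σ 5 0 0) (index σ 6 0 0)) ≡ true) where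
      e : Arc U W
      e = Equivalence.from T-≡ (≡.trans (≡.sym test≡adj) test)

      ω≡ : num σ 1 (index σ 5 0 0) (index σ 6 0 0) ≡ fromℕ (w e)
      ω≡ = ≡.trans (w≡ _ _ u<n v<n) (arcMatrix-arc e)

      π≡ : num σ 2 (index σ 5 0 0) (index σ 6 0 0) ≡ p e
      π≡ = ≡.trans (p≡ _ _ u<n v<n) (arcMatrix-arc e)

      -- The three moments are found by unification with `moments-◅`; only the minimum differs
      -- between the exits.
      extend : ∀ {d r} →
        Minimum (firstMoves k U (index σ 6 0 0) ++ map (e ◅_) (trajectories M k W)) d r →
        Summary (firstMoves k U (suc (index σ 6 0 0))) _ _ _ d r
      extend {d} {r} min = subst (λ zs → Summary zs _ _ _ d r)
        (≡.sym (≡.trans (firstMoves-suc k U v<n) (cong (firstMoves k U (index σ 6 0 0) ++_) (moveTo-arc e))))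
        (moments-◅ e ω≡ π≡ μ (proj₁ (row _ v<n v<n)) , min)

      arc : Runs _ σ (λ σ′ → Relaxing k u<n (suc (index σ 6 0 0)) (increment σ′ 6))
      arc = run-⨾ (run-:=ₙ (run-⨾ (run-:=ₙ (run-⨾ (run-:=ₙ (run-if
        (λ reach → run-if
          (λ keep → run-skip (refl , ctx , extend (minimum-keep e ω≡ reach keep m m′)))
          (λ replace → run-⨾ (run-:=ₙ (run-:=ᵢ
            (refl , ctx , extend (minimum-replace e ω≡ reach replace m m′))))))
        (λ unreach → run-skip (refl , ctx , extend (minimum-unreachable e ω≡ unreach m m′)))))))))

  cleared : Store K → Store K
  cleared σ = ⟨ write (index σ) 8 0 0 0
              , write (write (write (write (num σ) 9 0 0 0#) 10 0 0 0#) 11 0 0 0#) 12 0 0 0# ⟩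

  run-accumulate : ∀ {k u σ} (u<n : u < n) → RowPartial k u σ →
    Runs accumulate (cleared σ) (Accumulating k u (trajectories M (suc k) (fromℕ< u<n)))
  run-accumulate {σ = σ} u<n ctx@(((_ , _ , t≡ , _) , refl , _) , refl , _) = run-if
    (λ test → run-⨾ (run-:=ₙ (run-:=ᵢ (ctx , summary-t (suc k) (at-t test)))))
    (λ test → run-weaken (λ {σ′} → finish test {σ′}) (run-for (Relaxing k u<n)
      (λ inv → proj₁ (proj₁ (proj₁ (proj₁ (proj₂ inv)))))
      proj₁
      (λ {j} {σ} → run-relax {σ = σ} u<n)
      -- No successor has been visited yet, and the cleared cells summarise the empty list.
      (refl , ctx , summary-[])))
    where
    k = index σ 4 0 0
    u = index σ 5 0 0

    at-t : (u ≤ᵇ index σ 2 0 0) ∧ (index σ 2 0 0 ≤ᵇ u) ≡ true → fromℕ< u<n ≡ t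
    at-t test = Fin.toℕ-injective
      (≡.trans (Fin.toℕ-fromℕ< u<n) (≡.trans (≤ᵇ-antisym test) t≡))

    not-t : (u ≤ᵇ index σ 2 0 0) ∧ (index σ 2 0 0 ≤ᵇ u) ≡ false → fromℕ< u<n ≢ t
    not-t test u≡t = contradiction (≡.trans (≡.sym test)
      (≡.trans (cong (λ x → (u ≤ᵇ x) ∧ (x ≤ᵇ u)) t≡u) (≤ᵇ-∧-refl u))) λ ()
      where
      t≡u : index σ 2 0 0 ≡ u
      t≡u = ≡.trans t≡ (≡.trans (cong toℕ (≡.sym u≡t)) (Fin.toℕ-fromℕ< u<n))

    finish : (u ≤ᵇ index σ 2 0 0) ∧ (index σ 2 0 0 ≤ᵇ u) ≡ false → ∀ {σ′} →
             Relaxing k u<n n σ′ → Accumulating k u (trajectories M (suc k) (fromℕ< u<n)) σ′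
    finish test {σ′} (_ , ctx′ , acc) = ctx′ , subst (Accumulator σ′)
      (≡.trans (firstMoves-all k _) (≡.sym (trajectories-moves (suc k) (not-t test)))) acc

  -- Here `q` is the address test of `write`. The five cells of an entry are written at the same
  -- address, so one Boolean decides for the whole summary.
  summary-kept : ∀ {u} {xs : List (Path u t)} q {a b c d r a′ b′ c′ d′ r′} → q ≡ false →
    Summary xs a b c d r →
    Summary xs (if q then a′ else a) (if q then b′ else b) (if q then c′ else c)
               (if q then d′ else d) (if q then r′ else r)
  summary-kept false refl old = old

  summary-new : ∀ {u} {xs : List (Path u t)} q {a b c d r a′ b′ c′ d′ r′} → q ≡ true →
    Summary xs a′ b′ c′ d′ r′ →
    Summary xs (if q then a′ else a) (if q then b′ else b) (if q then c′ else c)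
               (if q then d′ else d) (if q then r′ else r)
  summary-new true refl new = new

  -- Row `k` survives because `suc k ≢ k`. In row `suc k`, position `u` receives the accumulator and
  -- smaller positions keep their entries.
  run-save : ∀ {k u σ} (u<n : u < n) → Accumulating k u (trajectories M (suc k) (fromℕ< u<n)) σ →
    Runs save σ (λ σ′ → RowPartial k (suc u) (increment σ′ 5))
  run-save {σ = σ} u<n (((inputs , refl , row) , refl , row′) , acc) =
    run-⨾ (run-:=ₙ (run-⨾ (run-:=ₙ (run-⨾ (run-:=ₙ (run-⨾ (run-:=ₙ (run-:=ᵢ
      ((inputs , refl , λ i i<n _ → summary-kept ((suc k ≡ᵇ k) ∧ (u ≡ᵇ i)) (other-row i) (row i i<n i<n))
      , refl , extended)))))))))
    where
    k = index σ 4 0 0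
    u = index σ 5 0 0

    other-row : ∀ i → (suc k ≡ᵇ k) ∧ (u ≡ᵇ i) ≡ false
    other-row i = cong (_∧ (u ≡ᵇ i)) (≡ᵇ-false {suc k} {k} ℕ.1+n≢n)

    extended : ∀ i (i<n : i < n) → i < suc u → _
    extended i i<n i<1+u with i ℕ.≟ u
    ... | yes refl = summary-new ((k ≡ᵇ k) ∧ (u ≡ᵇ u)) (cong₂ _∧_ (≡ᵇ-true k) (≡ᵇ-true u)) acc
    ... | no i≢u   = summary-kept ((k ≡ᵇ k) ∧ (u ≡ᵇ i))
      (≡.trans (cong ((k ≡ᵇ k) ∧_) (≡ᵇ-false (i≢u ∘ ≡.sym))) (∧-zeroʳ (k ≡ᵇ k)))
      (row′ i i<n (ℕ.≤∧≢⇒< (ℕ.s≤s⁻¹ i<1+u) i≢u))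

  run-fillRow : ∀ {k σ} → RowsDone k σ →
    Runs fillRow σ (λ σ′ → RowsDone (suc k) (increment σ′ 4))
  run-fillRow {k} done = run-weaken
    (λ ((inputs , k≡ , _) , _ , row′) → inputs , cong suc k≡ , row′)
    (run-for (RowPartial k) (λ inv → proj₁ (proj₁ (proj₁ inv))) (λ inv → proj₁ (proj₂ inv))
      (λ {u} {σ} u<n inv → run-⨾ (run-:=ₙ (run-⨾ (run-:=ₙ (run-⨾ (run-:=ₙ (run-⨾ (run-:=ₙ (run-⨾ (run-:=ᵢ
        (run-⨾ (run-weaken (λ {σ′} → run-save {σ = σ′} u<n) (run-accumulate {σ = σ} u<n inv)))))))))))))
      (done , refl , λ _ _ ()))

  -- Row `n` at `s` summarises `outcomes`, so both results are instances of `quadratic`.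
  run-report : ∀ {σ} → RowsDone n σ → Runs report σ (λ σ′ →
    output₁ {K = K} σ′ ≈ 𝔼 M (X M) × output₂ {K = K} σ′ ≈ Var M (X M))
  run-report {σ} ((n≡ , s≡ , _) , _ , row) =
    run-⨾ (run-:=ₙ (run-⨾ (run-:=ₙ (run-⨾ (run-:=ₙ (run-:=ₙ (expectation , variance)))))))
    where
    open SemiringSolver commutativeSemiring
    open SetoidReasoning setoid

    entry : Entry σ (index σ 0 0 0) (index σ 1 0 0) (outcomes M)
    entry = ≡.subst₂ (λ k i → Entry σ k i (outcomes M)) (≡.sym n≡) (≡.sym s≡)
      (subst (λ x → Entry σ n (toℕ s) (trajectories M n x)) (Fin.fromℕ<-toℕ s (Fin.toℕ<n s))
        (row (toℕ s) (Fin.toℕ<n s) (Fin.toℕ<n s)))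

    A B C D δ m μ δ′ : Carrier
    A = num σ 5 (index σ 0 0 0) (index σ 1 0 0)
    B = num σ 6 (index σ 0 0 0) (index σ 1 0 0)
    C = num σ 7 (index σ 0 0 0) (index σ 1 0 0)
    D = num σ 8 (index σ 0 0 0) (index σ 1 0 0)
    δ = 1# / D
    m = δ · B
    μ = 0# - m
    δ′ = fromℕ (distance M) ⁻¹

    -- The stored least cost agrees with `distance` up to `≈`, which congruence of the inverse
    -- carries over.
    δ′≈δ : δ′ ≈ δ
    δ′≈δ = ≈-sym (≈-trans (*-identityˡ _) (⁻¹-cong (minimum-distance (proj₂ entry))))

    X≈ : ∀ P → X M P ≈ fromℕ (cost P) · δ
    X≈ P = *-congˡ δ′≈δ

    expectation : m ≈ 𝔼 M (X M)
    expectation = ≈-sym (begin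
      𝔼 M (X M)
        ≈⟨ quadratic (proj₁ entry) 0# δ 0# (λ P → ≈-trans (*-congˡ (X≈ P))
             (solve 3 (λ q x δ → q :* (x :* δ) :=
               con 0 :* q :+ (δ :* (q :* x) :+ con 0 :* (q :* (x :* x)))) ≈-refl
               (probability M P) (fromℕ (cost P)) δ)) ⟩
      0# · A + (δ · B + 0# · C)
        ≈⟨ solve 4 (λ a b c δ → con 0 :* a :+ (δ :* b :+ con 0 :* c) := δ :* b) ≈-refl A B C δ ⟩
      m ∎)

    deviation : ∀ P → X M P - 𝔼 M (X M) ≈ fromℕ (cost P) · δ + μ
    deviation P = +-cong (X≈ P) (≈-trans (-‿cong (≈-sym expectation)) (≈-sym (+-identityˡ (- m))))

    -- The coefficients come from squaring `x · δ + μ`, the deviation of a path of cost `x`.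
    variance : μ · μ · A + ((μ + μ) · δ · B + δ · δ · C) ≈ Var M (X M)
    variance = ≈-sym (quadratic (proj₁ entry) (μ · μ) ((μ + μ) · δ) (δ · δ) (λ P →
      ≈-trans (*-congˡ (*-cong (deviation P) (deviation P)))
        (solve 4 (λ q x δ μ → q :* ((x :* δ :+ μ) :* (x :* δ :+ μ)) :=
          μ :* μ :* q :+ ((μ :+ μ) :* δ :* (q :* x) :+ δ :* δ :* (q :* (x :* x)))) ≈-refl
          (probability M P) (fromℕ (cost P)) δ μ)))

  -- `q` is the column test of the two writes into row 0: `t` has only the empty trajectory, and any
  -- other vertex has none without arcs.
  initial : ∀ {u} q → (q ≡ true → u ≡ t) → (q ≡ false → u ≢ t) →
    Summary (trajectories M 0 u) (if q then 1# else 0#) 0# 0# 0# (if q then 1 else 0)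
  initial true  u≡t _   = summary-t 0 (u≡t refl)
  initial false _   u≢t = subst (λ xs → Summary xs 0# 0# 0# 0# 0)
    (≡.sym (trajectories-moves 0 (u≢t refl))) summary-[]

  run-momentProgram : Runs momentProgram (input M) (λ σ →
    output₁ {K = K} σ ≈ 𝔼 M (X M) × output₂ {K = K} σ ≈ Var M (X M))
  run-momentProgram = run-⨾ (run-:=ₙ (run-⨾ (run-:=ᵢ (run-⨾
    (run-weaken (λ {σ} → run-report {σ})
      (run-for RowsDone (λ inv → proj₁ (proj₁ inv)) (λ inv → proj₁ (proj₂ inv))
        (λ {k} {σ} _ → run-fillRow {k} {σ})
        ((refl , refl , refl , (λ _ _ → pad-<) , (λ _ _ → pad-<) , (λ _ _ → pad-<)) , refl , row₀)))))))
    where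
    row₀ : ∀ i (i<n : i < n) → i < n →
      Summary (trajectories M 0 (fromℕ< i<n)) (if toℕ t ≡ᵇ i then 1# else 0#) 0# 0# 0#
        (if toℕ t ≡ᵇ i then 1 else 0)
    row₀ i i<n _ = initial (toℕ t ≡ᵇ i)
      (λ eq → Fin.toℕ-injective (≡.trans (Fin.toℕ-fromℕ< i<n)
        (≡.sym (ℕ.≡ᵇ⇒≡ (toℕ t) i (Equivalence.from T-≡ eq)))))
      (λ eq i≡t → contradiction
        (≡.trans (≡.sym eq) (≡.trans (cong (toℕ t ≡ᵇ_) (≡.trans (≡.sym (Fin.toℕ-fromℕ< i<n)) (cong toℕ i≡t)))
          (≡ᵇ-true (toℕ t)))) λ ())

theorem5 : ∀ {c ℓ₁ ℓ₂ : Level} →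
    Σ[ prog ∈ Program ] Σ[ C ∈ ℕ ]
    ((K : OrderedField c ℓ₁ ℓ₂) (M : Model K) → .{{_ : NonZero (distance M)}} →
    Σ[ steps ∈ ℕ ] Σ[ σ ∈ Store K ]
    (Exec K prog (input M) steps σ
    × steps ≤ C * Model.n M ^ 3
    × OrderedField._≈_ K (output₁ {K = K} σ) (𝔼 M (X M))
    × OrderedField._≈_ K (output₂ {K = K} σ) (Var M (X M))))
-- The nested loops over `k`, `u` and `v` make `depth momentProgram` compute to 3, so
-- `time-polynomial` yields the cubic bound with this coefficient.
theorem5 = momentProgram , time 1 momentProgram , λ K M →
  let open Execution.Runs (Correctness.run-momentProgram M)
      -- The vertex `s` shows that `n` is non-zero, as absorbing lower powers requires.
      instance n≢0 = Fin.nonZeroIndex (Model.s M)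
  in steps , final , exec , ℕ.≤-trans bounded (time-polynomial (Model.n M) momentProgram) , post
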